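{- Let $T=(V,E)$ be a tree. For any $u,v\in V$ with $d(u,v)\ge 3$, the intersection inequality $x_{uv}+x_{\vec u(v),\vec v(u)}\le x_{u,\vec v(u)}+x_{\vec u(v),v}$ defines a facet of $\mathrm{LMC}(T)$.
   Context: For a tree $T=(V,E)$ and distinct $u,v\in V$, $d(u,v)$ is the length of the unique $uv$-path $P_{uv}$ in $T$; if $d(u,v)\ge 2$, $\vec u(v)$ denotes the neighbor of $u$ on $P_{uv}$ (and $\vec v(u)$ the neighbor of $v$ on $P_{uv}$). Edges of $T$ are identified with pairs in $\binom{V}{2}$. A decomposition of $T$ is a partition of $V$ each of whose blocks induces a connected subtree; for such a decomposition, its lifted multicut is the set of pairs $ab\in\binom{V}{2}$ with $a,b$ in distinct blocks. $\mathrm{LMC}(T)\subseteq\mathbb{R}^{\binom{V}{2}}$ is the convex hull of the characteristic vectors of these lifted multicuts over all decompositions of $T$.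
   Formalization: LMC(T) is taken in the rational space indexed by pairs of vertices, as the set of rational convex combinations of the lifted multicut vectors, and the dimensions of LMC(T) and of the face are measured by affine independence over the rationals instead of the reals. -}

module Defs where

open import Data.Nat using (ℕ; zero; suc)
open import Data.Fin using (Fin; zero; suc; _<_; _<?_)
open import Data.Fin.Properties using (_≟_)
open import Data.List using (List; []; _∷_; _++_)
open import Data.List.Relation.Unary.All using (All)
open import Data.List.Relation.Unary.Unique.Propositional using (Unique)
open import Data.Product using (Σ; ∃; _×_; _,_)
open import Data.Rational using (ℚ; 0ℚ; 1ℚ) renaming (_+_ to _+q_; _*_ to _*q_; _≤_ to _≤q_)
open import Relation.Binary.PropositionalEquality using (_≡_)
open import Relation.Nullary using (¬_; yes; no)

record Graph (n : ℕ) : Set₁ where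
  field
    Adj    : Fin n → Fin n → Set
    sym    : ∀ {a b} → Adj a b → Adj b a
    irrefl : ∀ {a} → ¬ Adj a a
open Graph public

data Walk {n : ℕ} (G : Graph n) : Fin n → Fin n → Set where
  here : ∀ {u} → Walk G u u
  step : ∀ {u w v} → Adj G u w → Walk G w v → Walk G u v

vertices : ∀ {n} {G : Graph n} {u v} → Walk G u v → List (Fin n)
vertices {u = u} here = u ∷ []
vertices {u = u} (step _ w) = u ∷ vertices w

IsPath : ∀ {n} {G : Graph n} {u v} → Walk G u v → Set
IsPath w = Unique (vertices w)

IsTree : ∀ {n} → Graph n → Set
IsTree G = ∀ u v →
  Σ (Walk G u v) IsPath ×
  (∀ (p q : Walk G u v) → IsPath p → IsPath q → vertices p ≡ vertices q)

-- Decompositions, given by a block labelling f : V → Fin n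
-- (every partition of V arises this way); each block induces a
-- connected subgraph.

IsDecomposition : ∀ {n} → Graph n → (Fin n → Fin n) → Set
IsDecomposition G f = ∀ a b → f a ≡ f b →
  Σ (Walk G a b) λ w → All (λ c → f c ≡ f a) (vertices w)

Pair : ℕ → Set
Pair n = Σ (Fin n) λ a → Σ (Fin n) λ b → a < b

Point : ℕ → Set
Point n = Pair n → ℚ

-- the coordinate x_{ab} for an unordered pair {a,b} (a ≠ b)
coord : ∀ {n} → Point n → Fin n → Fin n → ℚ
coord x a b with a <? b
... | yes a<b = x (a , b , a<b)
... | no _ with b <? a
...   | yes b<a = x (b , a , b<a)
...   | no _ = 0ℚ

-- characteristic vector of the lifted multicut of decomposition f
χ : ∀ {n} → (Fin n → Fin n) → Point n
χ f (a , b , _) with f a ≟ f b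
... | yes _ = 0ℚ
... | no _ = 1ℚ

∑ : ∀ {k} → (Fin k → ℚ) → ℚ
∑ {zero} g = 0ℚ
∑ {suc k} g = g zero +q ∑ (λ i → g (suc i))

LMC : ∀ {n} → Graph n → Point n → Set
LMC {n} G x = Σ ℕ λ k → Σ (Fin k → ℚ) λ λs → Σ (Fin k → (Fin n → Fin n)) λ fs →
  (∀ i → IsDecomposition G (fs i)) ×
  (∀ i → 0ℚ ≤q λs i) ×
  (∑ λs ≡ 1ℚ) ×
  (∀ p → x p ≡ ∑ (λ i → λs i *q χ (fs i) p))

AffinelyIndependent : ∀ {n k} → (Fin k → Point n) → Set
AffinelyIndependent {n} {k} z = ∀ (c : Fin k → ℚ) → ∑ c ≡ 0ℚ →
  (∀ p → ∑ (λ i → c i *q z i p) ≡ 0ℚ) → ∀ i → c i ≡ 0ℚ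

HasDim : ∀ {n} → (Point n → Set) → ℕ → Set
HasDim {n} S d =
  (Σ (Fin (suc d) → Point n) λ z → (∀ i → S (z i)) × AffinelyIndependent z) ×
  (∀ (z : Fin (suc (suc d)) → Point n) → (∀ i → S (z i)) → ¬ AffinelyIndependent z)

DefinesFacet : ∀ {n} → (Point n → Set) → (Point n → ℚ) → (Point n → ℚ) → Set
DefinesFacet {n} P lhs rhs =
  (∀ x → P x → lhs x ≤q rhs x) ×
  Σ ℕ λ d → HasDim P (suc d) × HasDim (λ x → P x × (lhs x ≡ rhs x)) d

{-# OPTIONS --safe #-}

-- The inequality is strict (1 < 2) at a decomposition that cuts uu′ and vv′ but nothing between
-- u′ and v′, and tight at all others. With m = n(n-1)/2, affine independence of m points on the face
-- suffices for both dimensions, because one vertex off the face extends them to m + 1 points.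
-- To each pair ab we associate the decomposition whose only nontrivial block is the path from a
-- to b (with u or v added where needed to stay on the face), and to u′v′ the decomposition into
-- singletons. The vectors 1 − χ of these decompositions are triangular with respect to the
-- distance of a and b, ties being broken by whether a vertex was added.
module Submission where

open import Defs renaming (sym to Adj-sym)
open import Data.Bool using (if_then_else_)
open import Data.Fin using (Fin; zero; suc; toℕ; punchIn; _<_; _<?_)
import Data.Fin.Properties as Fin
open import Data.List using (List; []; _∷_; _++_; length)
open import Data.List.Membership.Propositional using (_∈_; _∉_)
open import Data.List.Membership.Propositional.Properties using (∈-++⁺ʳ)
open import Data.List.Properties using (∷-injectiveʳ)
open import Data.List.Relation.Binary.Subset.Propositional using (_⊆_)
open import Data.List.Relation.Unary.All as All using ([]; _∷_)
open import Data.List.Relation.Unary.All.Properties using (¬Any⇒All¬; All¬⇒¬Any)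
open import Data.List.Relation.Unary.AllPairs using ([]; _∷_)
open import Data.List.Relation.Unary.Any using (here; there)
open import Data.List.Relation.Unary.Unique.Propositional using (Unique)
open import Data.Nat as ℕ using (ℕ; zero; suc; s≤s; z<s; s<s)
import Data.Nat.Properties as ℕ
open import Data.Product using (Σ; ∃; _×_; _,_; proj₁; proj₂)
open import Data.Rational as ℚ using (ℚ; 0ℚ; 1ℚ; -_) renaming (_+_ to _+q_; _*_ to _*q_; _≤_ to _≤q_)
import Data.Rational.Properties as ℚ
open import Data.Rational.Solver using (module +-*-Solver)
open import Data.Sum as Sum using (_⊎_; inj₁; inj₂)
open import Data.Sum.Function.Propositional using (_⊎-↔_)
open import Data.Vec.Functional using (insertAt; removeAt)
open import Data.Vec.Functional.Properties using (insertAt-lookup; insertAt-punchIn)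
open import Function using (_∘_; id; _↔_; mk↔ₛ′; Inverse)
open import Function.Properties.Inverse using (↔-refl; ↔-trans)
open import Relation.Binary.PropositionalEquality using (_≡_; _≢_; refl; sym; trans; cong; cong₂; subst; module ≡-Reasoning)
open import Relation.Nullary using (¬_; Dec; yes; no; does; contradiction; decidable-stable; ¬?; _×-dec_)
open import Relation.Nullary.Decidable using (dec-true; dec-false)
open import Algebra.Properties.CommutativeMonoid.Sum ℚ.+-0-commutativeMonoid using (sum; sum-cong-≗; sum-remove; ∑-distrib-+)

-- Linear algebra over ℚ

∑≡sum : ∀ {k} (g : Fin k → ℚ) → ∑ g ≡ sum g
∑≡sum {zero}  g = refl
∑≡sum {suc k} g = cong (g zero +q_) (∑≡sum (g ∘ suc))

∑-cong : ∀ {k} {g h : Fin k → ℚ} → (∀ i → g i ≡ h i) → ∑ g ≡ ∑ h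
∑-cong {g = g} {h} g≗h = trans (∑≡sum g) (trans (sum-cong-≗ g≗h) (sym (∑≡sum h)))

∑-+ : ∀ {k} (g h : Fin k → ℚ) → ∑ (λ i → g i +q h i) ≡ ∑ g +q ∑ h
∑-+ g h = trans (∑≡sum λ i → g i +q h i)
  (trans (∑-distrib-+ g h) (cong₂ _+q_ (sym (∑≡sum g)) (sym (∑≡sum h))))

∑-remove : ∀ {k} (i : Fin (suc k)) (g : Fin (suc k) → ℚ) → ∑ g ≡ g i +q ∑ (removeAt g i)
∑-remove i g = trans (∑≡sum g)
  (trans (sum-remove g) (cong (g i +q_) (sym (∑≡sum (removeAt g i)))))

∑-zero : ∀ {k} {g : Fin k → ℚ} → (∀ i → g i ≡ 0ℚ) → ∑ g ≡ 0ℚ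
∑-zero {zero}  _   = refl
∑-zero {suc k} g≗0 = trans (cong₂ _+q_ (g≗0 zero) (∑-zero (g≗0 ∘ suc))) (ℚ.+-identityˡ 0ℚ)

∑-single : ∀ {k} (i : Fin k) {g : Fin k → ℚ} → (∀ j → j ≢ i → g j ≡ 0ℚ) → ∑ g ≡ g i
∑-single {suc k} i {g} others = trans (∑-remove i g)
  (trans (cong (g i +q_) (∑-zero λ j → others (punchIn i j) (Fin.punchInᵢ≢i i j)))
         (ℚ.+-identityʳ (g i)))

∑-*ʳ : ∀ {k} (g : Fin k → ℚ) (t : ℚ) → ∑ (λ i → g i *q t) ≡ ∑ g *q t
∑-*ʳ {zero}  g t = sym (ℚ.*-zeroˡ t)
∑-*ʳ {suc k} g t = trans (cong (g zero *q t +q_) (∑-*ʳ (g ∘ suc) t))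
  (sym (ℚ.*-distribʳ-+ t (g zero) (∑ (g ∘ suc))))

∑-mono : ∀ {k} {g h : Fin k → ℚ} → (∀ i → g i ≤q h i) → ∑ g ≤q ∑ h
∑-mono {zero}  _   = ℚ.≤-refl
∑-mono {suc k} g≤h = ℚ.+-mono-≤ (g≤h zero) (∑-mono (g≤h ∘ suc))

comb : ∀ {k} → (Fin k → ℚ) → (Fin k → ℚ) → ℚ
comb c g = ∑ λ i → c i *q g i

comb-+ : ∀ {k} (c g h : Fin k → ℚ) → comb c (λ i → g i +q h i) ≡ comb c g +q comb c h
comb-+ c g h = trans (∑-cong λ i → ℚ.*-distribˡ-+ (c i) (g i) (h i))
  (∑-+ (λ i → c i *q g i) (λ i → c i *q h i))

comb-1 : ∀ {k} (c : Fin k → ℚ) → comb c (λ _ → 1ℚ) ≡ ∑ c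
comb-1 c = ∑-cong λ i → ℚ.*-identityʳ (c i)

x*y≡0⇒x≡0 : ∀ {x y} → y ≢ 0ℚ → x *q y ≡ 0ℚ → x ≡ 0ℚ
x*y≡0⇒x≡0 {x} {y} y≢0 xy≡0 = begin
  x                      ≡⟨ ℚ.*-identityʳ x ⟨
  x *q 1ℚ                ≡⟨ cong (x *q_) (ℚ.*-inverseʳ y) ⟨
  x *q (y *q (ℚ.1/ y))   ≡⟨ ℚ.*-assoc x y (ℚ.1/ y) ⟨
  x *q y *q (ℚ.1/ y)     ≡⟨ cong (_*q (ℚ.1/ y)) xy≡0 ⟩
  0ℚ *q (ℚ.1/ y)         ≡⟨ ℚ.*-zeroˡ (ℚ.1/ y) ⟩
  0ℚ                     ∎
  where
  open ≡-Reasoning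
  instance
    y-nonZero : ℚ.NonZero y
    y-nonZero = ℚ.≢-nonZero y≢0

-- Gaussian elimination: more vectors than coordinates are linearly dependent

Dependent : ∀ {k r} → (Fin k → Fin r → ℚ) → Set
Dependent {k} z = ∃ λ (c : Fin k → ℚ) →
  (∃ λ i → c i ≢ 0ℚ) × (∀ s → comb c (λ i → z i s) ≡ 0ℚ)

-- Adding `t i` times the pivot row `j` to every other row clears column `zero`, so a relation among
-- the shortened rows holds in all columns. Regrouped, it is a relation among the original rows.
eliminate : ∀ {k r} (z : Fin (suc k) → Fin (suc r) → ℚ) (j : Fin (suc k)) → z j zero ≢ 0ℚ →
  (∀ (w : Fin k → Fin r → ℚ) → Dependent w) → Dependent z
eliminate {k} {r} z j pivot≢0 rec =
  e , (punchIn j i , λ eq → cᵢ≢0 (trans (sym (insertAt-punchIn c j eⱼ i)) eq)) , e-rel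
  where
  inv = (ℚ.1/ z j zero) {{ℚ.≢-nonZero pivot≢0}}

  t : Fin k → ℚ
  t i = - (z (punchIn j i) zero *q inv)

  relation : Dependent λ i s → z (punchIn j i) (suc s) +q t i *q z j (suc s)
  relation = rec _

  c = proj₁ relation
  i = proj₁ (proj₁ (proj₂ relation))
  cᵢ≢0 = proj₂ (proj₁ (proj₂ relation))

  -- Row `j` entered the `i`-th reduced row with factor `t i`; these contributions add up to its
  -- coefficient.
  eⱼ : ℚ
  eⱼ = comb c t

  e : Fin (suc k) → ℚ
  e = insertAt c j eⱼ

  pivot-column : ∀ i → z (punchIn j i) zero +q t i *q z j zero ≡ 0ℚ
  pivot-column i = trans
    (solve 3 (λ x y v → x :+ (:- (x :* v)) :* y := x :* (con 1ℚ :+ (:- (v :* y)))) refl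
      x (z j zero) inv)
    (trans (cong (λ s → x *q (1ℚ +q (- s))) (ℚ.*-inverseˡ (z j zero) {{ℚ.≢-nonZero pivot≢0}}))
      (ℚ.*-zeroʳ x))
    where
    open +-*-Solver
    x = z (punchIn j i) zero

  reduced : ∀ s → comb c (λ i → z (punchIn j i) s +q t i *q z j s) ≡ 0ℚ
  reduced zero    = ∑-zero λ i → trans (cong (c i *q_) (pivot-column i)) (ℚ.*-zeroʳ (c i))
  reduced (suc s) = proj₂ (proj₂ relation) s

  e-rel : ∀ s → comb e (λ i → z i s) ≡ 0ℚ
  e-rel s = begin
    comb e (λ i → z i s)
      ≡⟨ ∑-remove j (λ i → e i *q z i s) ⟩
    e j *q z j s +q ∑ (λ i → e (punchIn j i) *q z (punchIn j i) s)
      ≡⟨ cong₂ _+q_ (cong (_*q z j s) (insertAt-lookup c j eⱼ))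
                    (∑-cong λ i → cong (_*q z (punchIn j i) s) (insertAt-punchIn c j eⱼ i)) ⟩
    eⱼ *q z j s +q comb c (λ i → z (punchIn j i) s)
      ≡⟨ ℚ.+-comm (eⱼ *q z j s) _ ⟩
    comb c (λ i → z (punchIn j i) s) +q eⱼ *q z j s
      ≡⟨ cong (comb c (λ i → z (punchIn j i) s) +q_)
           (trans (sym (∑-*ʳ (λ i → c i *q t i) (z j s))) (∑-cong λ i → ℚ.*-assoc (c i) (t i) (z j s))) ⟩
    comb c (λ i → z (punchIn j i) s) +q comb c (λ i → t i *q z j s)
      ≡⟨ comb-+ c _ _ ⟨
    comb c (λ i → z (punchIn j i) s +q t i *q z j s)
      ≡⟨ reduced s ⟩
    0ℚ ∎
    where open ≡-Reasoning

dependent : ∀ k (z : Fin (suc k) → Fin k → ℚ) → Dependent z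
dependent zero    z = (λ _ → 1ℚ) , (zero , λ ()) , λ ()
dependent (suc k) z with Fin.any? (λ j → ¬? (z j zero ℚ.≟ 0ℚ))
... | yes (j , pivot≢0) = eliminate z j pivot≢0 (dependent k)
-- Column `zero` vanishes, so any relation respects it. Row `zero` is discarded too, with
-- coefficient 0, to keep one more row than columns.
... | no no-pivot with dependent k (λ i s → z (suc i) (suc s))
...   | c , (i , cᵢ≢0) , c-rel = insertAt c zero 0ℚ , (suc i , cᵢ≢0) , rel
  where
  rel : ∀ s → comb (insertAt c zero 0ℚ) (λ i → z i s) ≡ 0ℚ
  rel zero    = ∑-zero λ i → trans
    (cong (insertAt c zero 0ℚ i *q_)
      (decidable-stable (z i zero ℚ.≟ 0ℚ) λ zᵢ≢0 → no-pivot (i , zᵢ≢0)))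
    (ℚ.*-zeroʳ (insertAt c zero 0ℚ i))
  rel (suc s) = trans (cong₂ _+q_ (ℚ.*-zeroˡ (z zero (suc s))) (c-rel s)) (ℚ.+-identityˡ 0ℚ)

-- Triangular systems

bounded : ∀ {k} (g : Fin k → ℕ) → ∃ λ B → ∀ i → g i ℕ.< B
bounded {zero}  g = zero , λ ()
bounded {suc k} g with bounded (g ∘ suc)
... | B , g<B = suc (g zero) ℕ.+ B , λ where
  zero    → ℕ.m≤m+n (suc (g zero)) B
  (suc i) → ℕ.≤-trans (g<B i) (ℕ.m≤n+m B (suc (g zero)))

-- Apart from the diagonal entry, column `i` is supported on rows of larger rank. Descending
-- induction on the rank therefore leaves only `c i *q M i i` in the relation for column `i`.
triangular : ∀ {k} (M : Fin k → Fin k → ℚ) (rank : Fin k → ℕ) →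
  (∀ i → M i i ≢ 0ℚ) → (∀ i j → i ≢ j → M i j ≡ 0ℚ ⊎ rank j ℕ.< rank i) →
  ∀ c → (∀ j → comb c (λ i → M i j) ≡ 0ℚ) → ∀ i → c i ≡ 0ℚ
triangular {k} M rank diag off c rel = λ i → vanish (proj₁ B) i (ℕ.m≤n+m (proj₁ B) (rank i))
  where
  B = bounded rank

  -- `h` bounds the gap between `rank i` and the strict upper bound of all ranks; at 0 there is no
  -- such `i`.
  vanish : ∀ h i → proj₁ B ℕ.≤ rank i ℕ.+ h → c i ≡ 0ℚ
  vanish zero i B≤r = contradiction (proj₂ B i)
    (ℕ.≤⇒≯ (subst (proj₁ B ℕ.≤_) (ℕ.+-identityʳ (rank i)) B≤r))
  vanish (suc h) i B≤r = x*y≡0⇒x≡0 (diag i) (trans (sym (∑-single i others)) (rel i))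
    where
    others : ∀ j → j ≢ i → c j *q M j i ≡ 0ℚ
    others j j≢i with off j i j≢i
    ... | inj₁ Mji≡0 = trans (cong (c j *q_) Mji≡0) (ℚ.*-zeroʳ (c j))
    ... | inj₂ rᵢ<rⱼ = trans (cong (_*q M j i) (vanish h j (ℕ.≤-trans B≤r
            (ℕ.≤-trans (ℕ.≤-reflexive (ℕ.+-suc (rank i) h)) (ℕ.+-monoˡ-≤ h rᵢ<rⱼ)))))
          (ℚ.*-zeroˡ (M j i))

-- Unordered pairs as coordinates

pair-≡ : ∀ {n} {a b c d : Fin n} {a<b : a < b} {c<d : c < d} →
  a ≡ c → b ≡ d → _≡_ {A = Pair n} (a , b , a<b) (c , d , c<d)
pair-≡ {a = a} {b} {a<b = p} {q} refl refl = cong (λ lt → a , b , lt) (ℕ.<-irrelevant p q)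

infix 4 _≟ₚ_

_≟ₚ_ : ∀ {n} (p q : Pair n) → Dec (p ≡ q)
(a , b , _) ≟ₚ (c , d , _) with a Fin.≟ c | b Fin.≟ d
... | yes a≡c | yes b≡d = yes (pair-≡ a≡c b≡d)
... | no a≢c  | _       = no (a≢c ∘ cong proj₁)
... | yes _   | no b≢d  = no (b≢d ∘ cong (proj₁ ∘ proj₂))

pair-suc-↔ : ∀ n → (Fin n ⊎ Pair n) ↔ Pair (suc n)
pair-suc-↔ n = mk↔ₛ′ to from to∘from from∘to
  where
  to : Fin n ⊎ Pair n → Pair (suc n)
  to (inj₁ b)             = zero , suc b , z<s
  to (inj₂ (a , b , a<b)) = suc a , suc b , s<s a<b

  from : Pair (suc n) → Fin n ⊎ Pair n
  from (zero  , suc b , _)       = inj₁ b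
  from (suc a , suc b , s<s a<b) = inj₂ (a , b , a<b)

  to∘from : ∀ p → to (from p) ≡ p
  to∘from (zero  , suc b , _)       = pair-≡ refl refl
  to∘from (suc a , suc b , s<s a<b) = refl

  from∘to : ∀ p → from (to p) ≡ p
  from∘to (inj₁ b) = refl
  from∘to (inj₂ p) = refl

-- Going from `n` to `suc n` adds the `n` pairs that contain `zero`, so `m` is n(n-1)/2.
pairs-finite : ∀ n → ∃ λ m → Fin m ↔ Pair n
pairs-finite zero    = zero , mk↔ₛ′ (λ ()) (λ { (() , _) }) (λ { (() , _) }) (λ ())
pairs-finite (suc n) with pairs-finite n
... | m , e = n ℕ.+ m , ↔-trans Fin.+↔⊎ (↔-trans (↔-refl ⊎-↔ e) (pair-suc-↔ n))

-- Compares vertices given in unknown order with the ordered representative of their pair.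
Ends : ∀ {n} → Pair n → Fin n → Fin n → Set
Ends (c , d , _) a b = (a ≡ c × b ≡ d) ⊎ (b ≡ c × a ≡ d)

ends-unique : ∀ {n} {p q : Pair n} {a b} → Ends p a b → Ends q a b → p ≡ q
ends-unique (inj₁ (refl , refl)) (inj₁ (refl , refl)) = pair-≡ refl refl
ends-unique (inj₂ (refl , refl)) (inj₂ (refl , refl)) = pair-≡ refl refl
ends-unique {p = _ , _ , a<b} {_ , _ , b<a} (inj₁ (refl , refl)) (inj₂ (refl , refl)) =
  contradiction a<b (ℕ.<-asym b<a)
ends-unique {p = _ , _ , b<a} {_ , _ , a<b} (inj₂ (refl , refl)) (inj₁ (refl , refl)) =
  contradiction a<b (ℕ.<-asym b<a)

same-ends : ∀ {n} {p : Pair n} {a b c d} → Ends p a b → Ends p c d →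
  (a ≡ c × b ≡ d) ⊎ (a ≡ d × b ≡ c)
same-ends (inj₁ (refl , refl)) (inj₁ (refl , refl)) = inj₁ (refl , refl)
same-ends (inj₁ (refl , refl)) (inj₂ (refl , refl)) = inj₂ (refl , refl)
same-ends (inj₂ (refl , refl)) (inj₁ (refl , refl)) = inj₂ (refl , refl)
same-ends (inj₂ (refl , refl)) (inj₂ (refl , refl)) = inj₁ (refl , refl)

coord-pair : ∀ {n} {a b : Fin n} → a ≢ b → ∃ λ (p : Pair n) → (∀ x → coord x a b ≡ x p) ×
  Ends p a b
coord-pair {a = a} {b} a≢b with a <? b
... | yes a<b = (a , b , a<b) , (λ _ → refl) , inj₁ (refl , refl)
... | no a≮b with b <? a
...   | yes b<a = (b , a , b<a) , (λ _ → refl) , inj₂ (refl , refl)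
...   | no b≮a = contradiction (Fin.toℕ-injective (ℕ.≤-antisym (ℕ.≮⇒≥ b≮a) (ℕ.≮⇒≥ a≮b))) a≢b

-- Walks and paths

module _ {n : ℕ} where
  open import Data.List.Membership.DecPropositional (Fin._≟_ {n}) using (_∈?_)

  module _ {G : Graph n} where

    len : ∀ {a b} → Walk G a b → ℕ
    len here       = 0
    len (step _ w) = suc (len w)

    length-vertices : ∀ {a b} (w : Walk G a b) → length (vertices w) ≡ suc (len w)
    length-vertices here       = refl
    length-vertices (step _ w) = cong suc (length-vertices w)

    start∈ : ∀ {a b} (w : Walk G a b) → a ∈ vertices w
    start∈ here       = here refl
    start∈ (step _ _) = here refl

    end∈ : ∀ {a b} (w : Walk G a b) → b ∈ vertices w
    end∈ here       = here refl
    end∈ (step _ w) = there (end∈ w)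

    len-zero : ∀ {a b} (w : Walk G a b) → len w ≡ 0 → a ≡ b
    len-zero here _ = refl

    infixr 5 _⊙_

    _⊙_ : ∀ {a b c} → Walk G a b → Walk G b c → Walk G a c
    here     ⊙ w = w
    step e v ⊙ w = step e (v ⊙ w)

    len-⊙ : ∀ {a b c} (v : Walk G a b) (w : Walk G b c) → len (v ⊙ w) ≡ len v ℕ.+ len w
    len-⊙ here       w = refl
    len-⊙ (step _ v) w = cong suc (len-⊙ v w)

    ∈-⊙ : ∀ {a b c x} (v : Walk G a b) (w : Walk G b c) →
      x ∈ vertices (v ⊙ w) → x ∈ vertices v ⊎ x ∈ vertices w
    ∈-⊙ here       w x∈         = inj₂ x∈
    ∈-⊙ (step _ v) w (here x≡)  = inj₁ (here x≡)
    ∈-⊙ (step _ v) w (there x∈) = Sum.map₁ there (∈-⊙ v w x∈)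

    reverse : ∀ {a b} → Walk G a b → Walk G b a
    reverse here       = here
    reverse (step e w) = reverse w ⊙ step (Adj-sym G e) here

    len-reverse : ∀ {a b} (w : Walk G a b) → len (reverse w) ≡ len w
    len-reverse here       = refl
    len-reverse (step e w) = trans (len-⊙ (reverse w) _)
      (trans (ℕ.+-comm (len (reverse w)) 1) (cong suc (len-reverse w)))

    ∈-reverse : ∀ {a b} (w : Walk G a b) → vertices (reverse w) ⊆ vertices w
    ∈-reverse here       x∈ = x∈
    ∈-reverse (step e w) x∈ with ∈-⊙ (reverse w) (step (Adj-sym G e) here) x∈
    ... | inj₁ x∈w              = there (∈-reverse w x∈w)
    ... | inj₂ (here refl)      = there (start∈ w)
    ... | inj₂ (there (here x≡)) = here x≡

    record Split {a b} (w : Walk G a b) (c : Fin n) : Set where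
      field
        before     : Walk G a c
        after      : Walk G c b
        len-split  : len before ℕ.+ len after ≡ len w
        before⊆    : vertices before ⊆ vertices w
        after⊆     : vertices after ⊆ vertices w
        cover      : ∀ {x} → x ∈ vertices w → x ∈ vertices before ⊎ x ∈ vertices after
        after-path : IsPath w → IsPath after

      len-before : len before ℕ.≤ len w
      len-before = subst (len before ℕ.≤_) len-split (ℕ.m≤m+n _ _)

      len-after : len after ℕ.≤ len w
      len-after = subst (len after ℕ.≤_) len-split (ℕ.m≤n+m _ _)

      len-before< : c ≢ b → len before ℕ.< len w
      len-before< c≢b = subst (len before ℕ.<_) len-split
        (ℕ.m<m+n _ (ℕ.n≢0⇒n>0 (c≢b ∘ len-zero after)))

      len-after< : c ≢ a → len after ℕ.< len w
      len-after< c≢a = subst (len after ℕ.<_) len-split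
        (ℕ.m<n+m _ (ℕ.n≢0⇒n>0 (c≢a ∘ sym ∘ len-zero before)))

    trivial-split : ∀ {a b} (w : Walk G a b) → Split w a
    trivial-split w = record
      { before = here ; after = w ; len-split = refl
      ; before⊆ = λ { (here refl) → start∈ w } ; after⊆ = id
      ; cover = inj₂ ; after-path = id }

    split : ∀ {a b c} (w : Walk G a b) → c ∈ vertices w → Split w c
    split here       (here refl) = trivial-split here
    split (step e w) (here refl) = trivial-split (step e w)
    split (step e w) (there c∈w) = record
      { before     = step e before
      ; after      = after
      ; len-split  = cong suc len-split
      ; before⊆    = λ { (here x≡) → here x≡ ; (there x∈) → there (before⊆ x∈) }
      ; after⊆     = there ∘ after⊆
      ; cover      = λ { (here x≡) → inj₁ (here x≡) ; (there x∈) → Sum.map₁ there (cover x∈) }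
      ; after-path = λ { (_ ∷ path) → after-path path }
      }
      where open Split (split w c∈w)

    -- If the first vertex recurs on the erased remainder, the part from that occurrence on is
    -- already the path; otherwise the vertex can be put in front.
    loop-erase : ∀ {a b} (w : Walk G a b) →
      Σ (Walk G a b) λ q → IsPath q × vertices q ⊆ vertices w × len q ℕ.≤ len w
    loop-erase here = here , [] ∷ [] , id , ℕ.≤-refl
    loop-erase {a} (step e w) with loop-erase w
    ... | q , q-path , q⊆w , q≤w with a ∈? vertices q
    ...   | yes a∈q = after , after-path q-path , there ∘ q⊆w ∘ after⊆ ,
                      ℕ.m≤n⇒m≤1+n (ℕ.≤-trans len-after q≤w)
      where open Split (split q a∈q)
    ...   | no a∉q = step e q , ¬Any⇒All¬ _ a∉q ∷ q-path ,
                     (λ { (here x≡) → here x≡ ; (there x∈) → there (q⊆w x∈) }) , s≤s q≤w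

    head-vertices : ∀ {a b} (w : Walk G a b) {x xs} → vertices w ≡ x ∷ xs → a ≡ x
    head-vertices here       refl = refl
    head-vertices (step _ _) refl = refl

    last-step : ∀ {a b} (w : Walk G a b) xs {y z} →
      vertices w ≡ xs ++ y ∷ z ∷ [] → Adj G y z
    last-step here [] ()
    last-step here (_ ∷ []) ()
    last-step here (_ ∷ _ ∷ _) ()
    last-step (step e here) [] refl = e
    last-step (step e (step _ here)) [] ()
    last-step (step e (step _ (step _ _))) [] ()
    last-step (step e w) (x ∷ xs) eq = last-step w xs (∷-injectiveʳ eq)

  -- Paths, distances and convexity in a tree

  module Tree (T : Graph n) (tree : IsTree T) where

    path : ∀ a b → Walk T a b
    path a b = proj₁ (proj₁ (tree a b))

    path-isPath : ∀ a b → IsPath (path a b)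
    path-isPath a b = proj₂ (proj₁ (tree a b))

    infix 4 _∈[_,_]
    _∈[_,_] : Fin n → Fin n → Fin n → Set
    c ∈[ a , b ] = c ∈ vertices (path a b)

    dist : Fin n → Fin n → ℕ
    dist a b = len (path a b)

    path-unique : ∀ {a b} (q : Walk T a b) → IsPath q → vertices (path a b) ≡ vertices q
    path-unique {a} {b} q = proj₂ (tree a b) (path a b) q (path-isPath a b)

    -- Erasing the loops of `w` leaves a path, which by uniqueness has the vertices of `path a b`.
    path⊆walk : ∀ {a b} (w : Walk T a b) → vertices (path a b) ⊆ vertices w
    path⊆walk w x∈ with loop-erase w
    ... | q , q-path , q⊆w , _ = q⊆w (subst (_ ∈_) (path-unique q q-path) x∈)

    dist≤len : ∀ {a b} (w : Walk T a b) → dist a b ℕ.≤ len w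
    dist≤len {a} {b} w with loop-erase w
    ... | q , q-path , _ , q≤w = ℕ.≤-trans (ℕ.≤-reflexive (ℕ.suc-injective
      (trans (sym (length-vertices (path a b)))
        (trans (cong length (path-unique q q-path)) (length-vertices q))))) q≤w

    dist-sym : ∀ a b → dist a b ℕ.≤ dist b a
    dist-sym a b = ℕ.≤-trans (dist≤len (reverse (path b a))) (ℕ.≤-reflexive (len-reverse (path b a)))

    to-root : ∀ {a b c} → c ∈[ a , b ] →
      Σ (Walk T c a) λ w → vertices w ⊆ vertices (path a b)
    to-root {a} {b} c∈ = reverse before , before⊆ ∘ ∈-reverse before
      where open Split (split (path a b) c∈)

    -- Going from `c` back to `a` and on to `d` never leaves the path from `a` to `b`, and this walk
    -- contains `path c d`.
    convex : ∀ {a b c d} → c ∈[ a , b ] → d ∈[ a , b ] →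
      vertices (path c d) ⊆ vertices (path a b)
    convex c∈ d∈ x∈ with to-root c∈ | to-root d∈
    ... | v , v⊆ | w , w⊆ with ∈-⊙ v (reverse w) (path⊆walk (v ⊙ reverse w) x∈)
    ...   | inj₁ x∈v = v⊆ x∈v
    ...   | inj₂ x∈w = w⊆ (∈-reverse w x∈w)

    -- Cutting the path at `c`, and then the piece containing `d` at `d`, leaves a walk between the
    -- two. Unless they are the two endpoints, one of the cuts removes at least one edge.
    subpath-shorter : ∀ {a b c d} → c ∈[ a , b ] → d ∈[ a , b ] →
      ¬ (c ≡ a × d ≡ b) → ¬ (c ≡ b × d ≡ a) → dist c d ℕ.< dist a b
    subpath-shorter {a} {b} {c} {d} c∈ d∈ ≢ab ≢ba = Sum.[ d-first , c-first ] (C.cover d∈)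
      where
      module C = Split (split (path a b) c∈)

      d-first : d ∈ vertices C.before → dist c d ℕ.< dist a b
      d-first d∈′ = ℕ.≤-<-trans (ℕ.≤-trans (dist-sym c d) (dist≤len D.after)) (shorter (c Fin.≟ b))
        where
        module D = Split (split C.before d∈′)
        shorter : Dec (c ≡ b) → len D.after ℕ.< dist a b
        shorter (no c≢b)  = ℕ.≤-<-trans D.len-after (C.len-before< c≢b)
        shorter (yes c≡b) = ℕ.<-≤-trans (D.len-after< λ d≡a → ≢ba (c≡b , d≡a)) C.len-before

      c-first : d ∈ vertices C.after → dist c d ℕ.< dist a b
      c-first d∈′ = ℕ.≤-<-trans (dist≤len D.before) (shorter (c Fin.≟ a))
        where
        module D = Split (split C.after d∈′)
        shorter : Dec (c ≡ a) → len D.before ℕ.< dist a b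
        shorter (no c≢a)  = ℕ.≤-<-trans D.len-before (C.len-after< c≢a)
        shorter (yes c≡a) = ℕ.<-≤-trans (D.len-before< λ d≡b → ≢ab (c≡a , d≡b)) C.len-after

    -- After loop erasure `w` can be prefixed with `a` and remains a path, hence it is the path from
    -- `a` to `c`.
    detour : ∀ {a b c} → Adj T a b → (w : Walk T b c) → a ∉ vertices w → b ∈[ a , c ]
    detour e w a∉w with loop-erase w
    ... | q , q-path , q⊆w , _ = subst (_ ∈_)
      (sym (path-unique (step e q) (¬Any⇒All¬ _ (a∉w ∘ q⊆w) ∷ q-path)))
      (there (start∈ q))

  -- Lifted multicuts

  coord-cong : ∀ {x y : Point n} → (∀ p → x p ≡ y p) → ∀ a b → coord x a b ≡ coord y a b
  coord-cong x≗y a b with a <? b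
  ... | yes a<b = x≗y _
  ... | no _ with b <? a
  ...   | yes b<a = x≗y _
  ...   | no _ = refl

  coord-comb : ∀ {k} (c : Fin k → ℚ) (z : Fin k → Point n) a b →
    coord (λ p → comb c (λ i → z i p)) a b ≡ comb c (λ i → coord (z i) a b)
  coord-comb c z a b with a <? b
  ... | yes a<b = refl
  ... | no _ with b <? a
  ...   | yes b<a = refl
  -- Here `coord` takes its default value 0 on both sides.
  ...   | no _ = sym (∑-zero λ i → ℚ.*-zeroʳ (c i))

  χ-joined : ∀ (f : Fin n → Fin n) {a b} (a<b : a < b) → f a ≡ f b → χ f (a , b , a<b) ≡ 0ℚ
  χ-joined f {a} {b} _ eq with f a Fin.≟ f b
  ... | yes _ = refl
  ... | no ≢ = contradiction eq ≢

  χ-separated : ∀ (f : Fin n → Fin n) {a b} (a<b : a < b) → f a ≢ f b → χ f (a , b , a<b) ≡ 1ℚ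
  χ-separated f {a} {b} _ ≢ with f a Fin.≟ f b
  ... | yes eq = contradiction eq ≢
  ... | no _ = refl

  coord-joined : ∀ (f : Fin n → Fin n) {a b} → f a ≡ f b → coord (χ f) a b ≡ 0ℚ
  coord-joined f {a} {b} eq with a <? b
  ... | yes a<b = χ-joined f a<b eq
  ... | no _ with b <? a
  ...   | yes b<a = χ-joined f b<a (sym eq)
  ...   | no _ = refl

  coord-separated : ∀ (f : Fin n → Fin n) {a b} → f a ≢ f b → coord (χ f) a b ≡ 1ℚ
  coord-separated f {a} {b} ≢ with coord-pair {a = a} {b} (≢ ∘ cong f)
  ... | (_ , _ , a<b) , eq , inj₁ (refl , refl) = trans (eq (χ f)) (χ-separated f a<b ≢)
  ... | (_ , _ , b<a) , eq , inj₂ (refl , refl) = trans (eq (χ f)) (χ-separated f b<a (≢ ∘ sym))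

  coord-χ≤1 : ∀ (f : Fin n → Fin n) a b → coord (χ f) a b ≤q 1ℚ
  coord-χ≤1 f a b with f a Fin.≟ f b
  ... | yes eq = ℚ.≤-trans (ℚ.≤-reflexive (coord-joined f eq)) (ℚ.nonNegative⁻¹ 1ℚ)
  ... | no ≢   = ℚ.≤-reflexive (coord-separated f ≢)

  coord-χ-cong : ∀ (f : Fin n → Fin n) {a b c d} → f a ≡ f c → f b ≡ f d →
    coord (χ f) a b ≡ coord (χ f) c d
  coord-χ-cong f {a} {b} a~c b~d with f a Fin.≟ f b
  ... | yes a~b = trans (coord-joined f a~b)
                    (sym (coord-joined f (trans (sym a~c) (trans a~b b~d))))
  ... | no a≁b = trans (coord-separated f a≁b)
                   (sym (coord-separated f λ c~d → a≁b (trans a~c (trans c~d (sym b~d)))))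

  χ∈LMC : ∀ {G : Graph n} {f} → IsDecomposition G f → LMC G (χ f)
  χ∈LMC {f = f} dec = 1 , (λ _ → 1ℚ) , (λ _ → f) , (λ _ → dec) ,
    (λ _ → ℚ.nonNegative⁻¹ 1ℚ) , refl ,
    λ p → sym (trans (ℚ.+-identityʳ (1ℚ *q χ f p)) (ℚ.*-identityˡ (χ f p)))

  -- The source of both upper bounds on dimension: some nontrivial combination of the points is
  -- annihilated by all `k` functionals, and if these determine the coefficient sum and every
  -- coordinate, it is an affine dependence.
  ¬independent : ∀ {k} (z : Fin (suc k) → Point n) (ℓ : Fin k → Point n → ℚ) →
    (∀ c → (∀ s → comb c (ℓ s ∘ z) ≡ 0ℚ) →
      ∑ c ≡ 0ℚ × (∀ p → comb c (λ i → z i p) ≡ 0ℚ)) →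
    ¬ AffinelyIndependent z
  ¬independent {k} z ℓ determine independent with dependent k (λ i s → ℓ s (z i))
  ... | c , (i , cᵢ≢0) , rel with determine c rel
  ...   | ∑c≡0 , c-rel = cᵢ≢0 (independent c ∑c≡0 c-rel i)

  -- The decomposition with block S, labelled by r, and all other blocks singletons.
  label : List (Fin n) → Fin n → Fin n → Fin n
  label S r c = if does (c ∈? S) then r else c

  module _ {S : List (Fin n)} {r : Fin n} where

    label-∈ : ∀ {c} → c ∈ S → label S r c ≡ r
    label-∈ {c} c∈S rewrite dec-true (c ∈? S) c∈S = refl

    label-joins : ∀ {c d} → c ∈ S → d ∈ S → label S r c ≡ label S r d
    label-joins c∈S d∈S = trans (label-∈ c∈S) (sym (label-∈ d∈S))

    -- Because `r` itself lies in `S`, no vertex outside `S` carries the label `r`.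
    label-≡ : r ∈ S → ∀ {c d} → label S r c ≡ label S r d → c ≡ d ⊎ (c ∈ S × d ∈ S)
    label-≡ r∈S {c} {d} eq with c ∈? S | d ∈? S
    ... | yes c∈ | yes d∈ = inj₂ (c∈ , d∈)
    ... | yes c∈ | no d∉  = contradiction (subst (_∈ S) eq r∈S) d∉
    ... | no c∉  | yes d∈ = contradiction (subst (_∈ S) (sym eq) r∈S) c∉
    ... | no _   | no _   = inj₁ eq

    label-apart : r ∈ S → ∀ {c d} → c ≢ d → ¬ (c ∈ S × d ∈ S) → label S r c ≢ label S r d
    label-apart r∈S c≢d ∉S eq = Sum.[ c≢d , ∉S ] (label-≡ r∈S eq)

    label-decomposition : ∀ {G : Graph n} → r ∈ S →
      (∀ {c} → c ∈ S → Σ (Walk G c r) λ w → vertices w ⊆ S) →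
      IsDecomposition G (label S r)
    label-decomposition r∈S connected a b eq with label-≡ r∈S eq
    ... | inj₁ refl = here , refl ∷ []
    ... | inj₂ (a∈S , b∈S) with connected a∈S | connected b∈S
    ...   | v , v⊆S | w , w⊆S = v ⊙ reverse w , All.tabulate λ x∈ → label-joins (in-block x∈) a∈S
      where
      in-block : vertices (v ⊙ reverse w) ⊆ S
      in-block x∈ with ∈-⊙ v (reverse w) x∈
      ... | inj₁ x∈v = v⊆S x∈v
      ... | inj₂ x∈w = w⊆S (∈-reverse w x∈w)

  -- The facet

  -- The order u, u′, ..., v′, v along the path is encoded by three memberships; `u′ ≢ v′` expresses
  -- that `u` and `v` have distance at least 3.
  module Intersection (T : Graph n) (tree : IsTree T) (u u′ v′ v : Fin n)
    (u~u′ : Adj T u u′) (v~v′ : Adj T v v′)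
    (u≢v : u ≢ v) (u≢v′ : u ≢ v′) (u′≢v : u′ ≢ v) (u′≢v′ : u′ ≢ v′)
    (u′∈[u,v] : u′ ∈ vertices (Tree.path T tree u v))
    (u′∈[u,v′] : u′ ∈ vertices (Tree.path T tree u v′))
    (v′∈[u′,v] : v′ ∈ vertices (Tree.path T tree u′ v)) where

    open Tree T tree

    -- Tight decompositions and validity of the inequality

    lhs rhs : Point n → ℚ
    lhs x = coord x u v +q coord x u′ v′
    rhs x = coord x u v′ +q coord x u′ v

    u≢u′ : u ≢ u′
    u≢u′ refl = irrefl T u~u′

    v≢v′ : v ≢ v′
    v≢v′ refl = irrefl T v~v′

    coord-pair-comb : ∀ {k} (c : Fin k → ℚ) (z : Fin k → Point n) a b a′ b′ →
      let x = λ p → comb c (λ i → z i p) in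
      coord x a b +q coord x a′ b′ ≡ comb c (λ i → coord (z i) a b +q coord (z i) a′ b′)
    coord-pair-comb c z a b a′ b′ = trans
      (cong₂ _+q_ (coord-comb c z a b) (coord-comb c z a′ b′))
      (sym (comb-+ c (λ i → coord (z i) a b) (λ i → coord (z i) a′ b′)))

    -- If `uu′` or `vv′` is uncut, the terms of the two sides agree in pairs; if all four pairs are
    -- cut, both sides are 2.
    Tight : (Fin n → Fin n) → Set
    Tight f = f u ≡ f u′ ⊎ f v ≡ f v′ ⊎
      (f u ≢ f v × f u′ ≢ f v′ × f u ≢ f v′ × f u′ ≢ f v)

    tight⇒≡ : ∀ f → Tight f → lhs (χ f) ≡ rhs (χ f)
    tight⇒≡ f (inj₁ eq) = trans
      (cong₂ _+q_ (coord-χ-cong f {b = v} eq refl) (coord-χ-cong f {b = v′} (sym eq) refl))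
      (ℚ.+-comm (coord (χ f) u′ v) (coord (χ f) u v′))
    tight⇒≡ f (inj₂ (inj₁ eq)) =
      cong₂ _+q_ (coord-χ-cong f {u} refl eq) (coord-χ-cong f {u′} refl (sym eq))
    tight⇒≡ f (inj₂ (inj₂ (uv , u′v′ , uv′ , u′v))) = trans
      (cong₂ _+q_ (coord-separated f uv) (coord-separated f u′v′))
      (sym (cong₂ _+q_ (coord-separated f uv′) (coord-separated f u′v)))

    -- The walk inside the block contains the tree path.
    along-block : ∀ {f} → IsDecomposition T f → ∀ {a b c} → f a ≡ f b → c ∈[ a , b ] → f c ≡ f a
    along-block dec {a} {b} eq c∈ with dec a b eq
    ... | w , in-block = All.lookup in-block (path⊆walk w c∈)

    -- If `uv′` or `u′v` is uncut, the block contains the path between its ends, hence `uu′` or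
    -- `vv′`, and equality holds. Otherwise the right side is 2, which the left side cannot exceed.
    valid-χ : ∀ {f} → IsDecomposition T f → lhs (χ f) ≤q rhs (χ f)
    valid-χ {f} dec with f u Fin.≟ f v′ | f u′ Fin.≟ f v
    ... | yes eq | _ = ℚ.≤-reflexive (tight⇒≡ f (inj₁ (sym (along-block dec eq u′∈[u,v′]))))
    ... | no _ | yes eq = ℚ.≤-reflexive (tight⇒≡ f
            (inj₂ (inj₁ (trans (sym eq) (sym (along-block dec eq v′∈[u′,v]))))))
    ... | no uv′ | no u′v = ℚ.≤-trans
            (ℚ.+-mono-≤ (coord-χ≤1 f u v) (coord-χ≤1 f u′ v′))
            (ℚ.≤-reflexive (sym (cong₂ _+q_ (coord-separated f uv′) (coord-separated f u′v))))

    valid : ∀ x → LMC T x → lhs x ≤q rhs x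
    valid x (k , λs , fs , decs , λs≥0 , _ , x≡) = begin
      lhs x                     ≡⟨ cong₂ _+q_ (coord-cong x≡ u v) (coord-cong x≡ u′ v′) ⟩
      lhs _                     ≡⟨ coord-pair-comb λs (χ ∘ fs) u v u′ v′ ⟩
      comb λs (lhs ∘ χ ∘ fs)    ≤⟨ ∑-mono (λ i → ℚ.*-monoˡ-≤-nonNeg (λs i)
                                     {{ℚ.nonNegative (λs≥0 i)}} (valid-χ (decs i))) ⟩
      comb λs (rhs ∘ χ ∘ fs)    ≡⟨ coord-pair-comb λs (χ ∘ fs) u v′ u′ v ⟨
      rhs _                     ≡⟨ cong₂ _+q_ (coord-cong x≡ u v′) (coord-cong x≡ u′ v) ⟨
      rhs x                     ∎
      where open ℚ.≤-Reasoning

    -- The blocks of the points on the face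

    Bad : Fin n → Fin n → Set
    Bad a b = u′ ∈[ a , b ] × v′ ∈[ a , b ] × ¬ u ∈[ a , b ] × ¬ v ∈[ a , b ]

    bad? : ∀ a b → Dec (Bad a b)
    bad? a b = (u′ ∈? P) ×-dec (v′ ∈? P) ×-dec ¬? (u ∈? P) ×-dec ¬? (v ∈? P)
      where P = vertices (path a b)

    Side : Fin n → Fin n → Set
    Side w w′ = (w ≡ u × w′ ≡ u′) ⊎ (w ≡ v × w′ ≡ v′)

    -- The block used for the pair ab. A path containing u′ and v′ but neither u nor v (a bad
    -- pair) would give a decomposition off the face; it is repaired by adding u or v, chosen so
    -- that the neighbour through which it is attached is not an endpoint of the path. This is
    -- impossible exactly for the pair u′v′, which contributes the all-singletons decomposition.
    data Shape (a b : Fin n) : List (Fin n) → Set where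
      good     : ¬ (u′ ∈ a ∷ b ∷ [] × v′ ∈ a ∷ b ∷ []) → ¬ Bad a b → Shape a b (vertices (path a b))
      extended : ∀ {w w′} → Bad a b → Side w w′ →
                 w′ ∉ a ∷ b ∷ [] → Shape a b (w ∷ vertices (path a b))
      single   : u′ ∈ a ∷ b ∷ [] → v′ ∈ a ∷ b ∷ [] → Shape a b (a ∷ [])

    shape : ∀ a b → ∃ (Shape a b)
    shape a b with u′ ∈? a ∷ b ∷ [] | v′ ∈? a ∷ b ∷ [] | bad? a b
    ... | yes u′∈ | yes v′∈ | _       = _ , single u′∈ v′∈
    ... | no u′∉  | _       | yes bad = _ , extended bad (inj₁ (refl , refl)) u′∉
    ... | no u′∉  | _       | no ¬bad = _ , good (u′∉ ∘ proj₁) ¬bad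
    ... | yes _   | no v′∉  | yes bad = _ , extended bad (inj₂ (refl , refl)) v′∉
    ... | yes _   | no v′∉  | no ¬bad = _ , good (v′∉ ∘ proj₂) ¬bad

    root∈ : ∀ {a b S} → Shape a b S → a ∈ S
    root∈ {a} {b} (good _ _)         = start∈ (path a b)
    root∈ {a} {b} (extended _ _ _) = there (start∈ (path a b))
    root∈         (single _ _)     = here refl

    block-decomposition : ∀ {a b S} → Shape a b S → IsDecomposition T (label S a)
    block-decomposition {a} {b} {S} s = label-decomposition (root∈ s) (connected s)
      where
      connected : ∀ {S} → Shape a b S → ∀ {c} → c ∈ S → Σ (Walk T c a) λ w → vertices w ⊆ S
      connected (good _ _) c∈ = to-root c∈
      connected (extended _ _ _) (there c∈) with to-root c∈
      ... | w , w⊆ = w , there ∘ w⊆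
      connected (extended (u′∈ , _) (inj₁ (refl , refl)) _) (here refl) with to-root u′∈
      ... | w , w⊆ = step u~u′ w , λ { (here x≡) → here x≡ ; (there x∈) → there (w⊆ x∈) }
      connected (extended (_ , v′∈ , _) (inj₂ (refl , refl)) _) (here refl) with to-root v′∈
      ... | w , w⊆ = step v~v′ w , λ { (here x≡) → here x≡ ; (there x∈) → there (w⊆ x∈) }
      connected (single _ _) (here refl) = here , id

    -- The first three conditions hold when `S` is convex. The last one excludes the only remaining
    -- slack pattern, a block with `u′` and `v′` but neither `u` nor `v`.
    label-tight : ∀ {S r} → r ∈ S →
      (u ∈ S → v′ ∈ S → u′ ∈ S) → (u ∈ S → v ∈ S → u′ ∈ S) → (u′ ∈ S → v ∈ S → v′ ∈ S) →
      (u′ ∈ S → v′ ∈ S → u ∈ S ⊎ v ∈ S) → Tight (label S r)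
    label-tight {S} {r} r∈S uv′ uv u′v u′v′ = cases (u ∈? S) (u′ ∈? S) (v ∈? S) (v′ ∈? S)
      where
      apart : ∀ {c d} → c ≢ d → ¬ (c ∈ S × d ∈ S) → label S r c ≢ label S r d
      apart = label-apart r∈S

      all-apart : (u ∈ S ⊎ u′ ∈ S → ¬ (v ∈ S ⊎ v′ ∈ S)) → Tight (label S r)
      all-apart away = inj₂ (inj₂
        ( apart u≢v   (λ (u∈ , v∈) → away (inj₁ u∈) (inj₁ v∈))
        , apart u′≢v′ (λ (u′∈ , v′∈) → away (inj₂ u′∈) (inj₂ v′∈))
        , apart u≢v′  (λ (u∈ , v′∈) → away (inj₁ u∈) (inj₂ v′∈))
        , apart u′≢v  (λ (u′∈ , v∈) → away (inj₂ u′∈) (inj₁ v∈))))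

      cases : Dec (u ∈ S) → Dec (u′ ∈ S) → Dec (v ∈ S) → Dec (v′ ∈ S) → Tight (label S r)
      cases (yes u∈) (yes u′∈) _        _         = inj₁ (label-joins u∈ u′∈)
      cases (yes u∈) (no u′∉)  _        _         =
        all-apart λ _ → u′∉ ∘ Sum.[ uv u∈ , uv′ u∈ ]
      cases (no u∉)  (no u′∉)  _        _         =
        all-apart λ near → contradiction near Sum.[ u∉ , u′∉ ]
      cases (no _)   (yes u′∈) (yes v∈) _         = inj₂ (inj₁ (label-joins v∈ (u′v u′∈ v∈)))
      cases (no u∉)  (yes u′∈) (no v∉)  (yes v′∈) = contradiction (u′v′ u′∈ v′∈) Sum.[ u∉ , v∉ ]
      cases (no _)   (yes _)   (no v∉)  (no v′∉)  = all-apart λ _ → Sum.[ v∉ , v′∉ ]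

    -- A path is convex and, when not bad, satisfies the last condition of `label-tight`. An added
    -- vertex leaves `uu′` or `vv′` uncut, and a one-vertex block contains no two of the four
    -- vertices.
    block-tight : ∀ {a b S} → Shape a b S → Tight (label S a)
    block-tight {a} {b} s@(good _ ¬bad) = label-tight (root∈ s)
      (λ u∈ v′∈ → convex u∈ v′∈ u′∈[u,v′]) (λ u∈ v∈ → convex u∈ v∈ u′∈[u,v])
      (λ u′∈ v∈ → convex u′∈ v∈ v′∈[u′,v])
      (λ u′∈ v′∈ → hits u′∈ v′∈ (u ∈? P) (v ∈? P))
      where
      P = vertices (path a b)
      hits : u′ ∈ P → v′ ∈ P → Dec (u ∈ P) → Dec (v ∈ P) → u ∈ P ⊎ v ∈ P
      hits _   _   (yes u∈) _        = inj₁ u∈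
      hits _   _   (no _)   (yes v∈) = inj₂ v∈
      hits u′∈ v′∈ (no u∉)  (no v∉)  = contradiction (u′∈ , v′∈ , u∉ , v∉) ¬bad
    block-tight (extended (u′∈ , _) (inj₁ (refl , refl)) _) =
      inj₁ (label-joins (here refl) (there u′∈))
    block-tight (extended (_ , v′∈ , _) (inj₂ (refl , refl)) _) =
      inj₂ (inj₁ (label-joins (here refl) (there v′∈)))
    block-tight {a} s@(single _ _) = label-tight (root∈ s)
      (λ u∈ v′∈ → contradiction (equal u∈ v′∈) u≢v′) (λ u∈ v∈ → contradiction (equal u∈ v∈) u≢v)
      (λ u′∈ v∈ → contradiction (equal u′∈ v∈) u′≢v)
      (λ u′∈ v′∈ → contradiction (equal u′∈ v′∈) u′≢v′)
      where
      equal : ∀ {c d} → c ∈ a ∷ [] → d ∈ a ∷ [] → c ≡ d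
      equal (here c≡a) (here d≡a) = trans c≡a (sym d≡a)

    -- The order dist first, good before bad: every pair joined by the block of ab other than ab
    -- itself comes strictly before ab.
    rank : Fin n → Fin n → ℕ
    rank a b = if does (bad? a b) then suc (dist a b ℕ.+ dist a b) else dist a b ℕ.+ dist a b

    rank-bad : ∀ {a b} → Bad a b → rank a b ≡ suc (dist a b ℕ.+ dist a b)
    rank-bad {a} {b} bad rewrite dec-true (bad? a b) bad = refl

    rank-good : ∀ {a b} → ¬ Bad a b → rank a b ≡ dist a b ℕ.+ dist a b
    rank-good {a} {b} ¬bad rewrite dec-false (bad? a b) ¬bad = refl

    rank≤ : ∀ a b → rank a b ℕ.≤ suc (dist a b ℕ.+ dist a b)
    rank≤ a b with bad? a b
    ... | yes bad = ℕ.≤-reflexive (rank-bad bad)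
    ... | no ¬bad = ℕ.≤-trans (ℕ.≤-reflexive (rank-good ¬bad)) (ℕ.n≤1+n _)

    ≤rank : ∀ a b → dist a b ℕ.+ dist a b ℕ.≤ rank a b
    ≤rank a b with bad? a b
    ... | yes bad = ℕ.≤-trans (ℕ.n≤1+n _) (ℕ.≤-reflexive (sym (rank-bad bad)))
    ... | no ¬bad = ℕ.≤-reflexive (sym (rank-good ¬bad))

    -- Doubling the distance in `rank` leaves room for the tie-breaking 1.
    rank-mono : ∀ {a b c d} → dist c d ℕ.< dist a b → rank c d ℕ.< rank a b
    rank-mono {a} {b} {c} {d} lt = begin
      suc (rank c d)                        ≤⟨ s≤s (rank≤ c d) ⟩
      suc (suc (dist c d ℕ.+ dist c d))     ≡⟨ cong suc (ℕ.+-suc (dist c d) (dist c d)) ⟨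
      suc (dist c d) ℕ.+ suc (dist c d)     ≤⟨ ℕ.+-mono-≤ lt lt ⟩
      dist a b ℕ.+ dist a b                 ≤⟨ ≤rank a b ⟩
      rank a b                              ∎
      where open ℕ.≤-Reasoning

    rank-good<bad : ∀ {a b c d} → ¬ Bad c d → Bad a b → dist c d ℕ.≤ dist a b →
      rank c d ℕ.< rank a b
    rank-good<bad ¬bad bad le rewrite rank-good ¬bad | rank-bad bad = s≤s (ℕ.+-mono-≤ le le)

    side-Adj : ∀ {w w′} → Side w w′ → Adj T w w′
    side-Adj (inj₁ (refl , refl)) = u~u′
    side-Adj (inj₂ (refl , refl)) = v~v′

    bad∋side : ∀ {a b w w′} → Side w w′ → Bad a b → w′ ∈[ a , b ]
    bad∋side (inj₁ (refl , refl)) (u′∈ , _)     = u′∈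
    bad∋side (inj₂ (refl , refl)) (_ , v′∈ , _) = v′∈

    ∋side⇒good : ∀ {w w′ c d} → Side w w′ → w ∈[ c , d ] → ¬ Bad c d
    ∋side⇒good (inj₁ (refl , refl)) u∈ (_ , _ , u∉ , _) = u∉ u∈
    ∋side⇒good (inj₂ (refl , refl)) v∈ (_ , _ , _ , v∉) = v∉ v∈

    -- As `w′` is not an endpoint, its distance to `c` is strictly below `dist a b`, and the edge to
    -- `w` adds only 1.
    dist-side : ∀ {a b c w w′} → Side w w′ → Bad a b → w′ ∉ a ∷ b ∷ [] → c ∈[ a , b ] →
      dist w c ℕ.≤ dist a b
    dist-side {c = c} {w′ = w′} side bad w′∉ c∈ = ℕ.≤-trans
      (dist≤len (step (side-Adj side) (path w′ c)))
      (subpath-shorter (bad∋side side bad) c∈ (λ (w′≡a , _) → w′∉ (here w′≡a))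
        (λ (w′≡b , _) → w′∉ (there (here w′≡b))))

    -- Other pairs on the path are closer than `a` and `b`. A pair with the added vertex may be
    -- equally far, but its path contains `u` or `v`, so it is good and precedes the bad pair `ab`.
    block-rank : ∀ {a b c d S} → a < b → c < d → Shape a b S → c ∈ S → d ∈ S →
      ¬ (c ≡ a × d ≡ b) → rank c d ℕ.< rank a b
    block-rank {a} {b} {c} {d} a<b c<d = go
      where
      inside : c ∈[ a , b ] → d ∈[ a , b ] → ¬ (c ≡ a × d ≡ b) → rank c d ℕ.< rank a b
      inside c∈ d∈ ≢ab = rank-mono (subpath-shorter c∈ d∈ ≢ab
        λ { (refl , refl) → ℕ.<-asym a<b c<d })

      go : ∀ {S} → Shape a b S → c ∈ S → d ∈ S → ¬ (c ≡ a × d ≡ b) → rank c d ℕ.< rank a b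
      go (good _ _) c∈ d∈ ≢ab = inside c∈ d∈ ≢ab
      go (extended _ _ _) (there c∈) (there d∈) ≢ab = inside c∈ d∈ ≢ab
      go (extended _ _ _) (here refl) (here refl) _ = contradiction c<d (ℕ.<-irrefl refl)
      go (extended bad side w′∉) (here refl) (there d∈) _ =
        rank-good<bad (∋side⇒good side (start∈ (path c d))) bad (dist-side side bad w′∉ d∈)
      go (extended bad side w′∉) (there c∈) (here refl) _ =
        rank-good<bad (∋side⇒good side (end∈ (path c d))) bad
          (ℕ.≤-trans (dist-sym c d) (dist-side side bad w′∉ c∈))
      go (single _ _) (here refl) (here refl) _ = contradiction c<d (ℕ.<-irrefl refl)

    -- A decomposition off the face

    u∉[u′,v′] : ¬ u ∈[ u′ , v′ ]
    -- Otherwise `dist u v′` and `dist u′ v′` would each be smaller than the other.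
    u∉[u′,v′] u∈ = ℕ.<-asym
      (subpath-shorter u∈ (end∈ (path u′ v′)) (u≢u′ ∘ proj₁) (u≢v′ ∘ proj₁))
      (subpath-shorter u′∈[u,v′] (end∈ (path u v′)) (u≢u′ ∘ sym ∘ proj₁) (u′≢v′ ∘ proj₁))

    v∉[u′,v′] : ¬ v ∈[ u′ , v′ ]
    v∉[u′,v′] v∈ = ℕ.<-asym
      (subpath-shorter (start∈ (path u′ v′)) v∈ (v≢v′ ∘ proj₂) (u′≢v′ ∘ proj₁))
      (subpath-shorter (start∈ (path u′ v)) v′∈[u′,v] (v≢v′ ∘ sym ∘ proj₂) (u′≢v ∘ proj₁))

    slack : Fin n → Fin n
    slack = label (vertices (path u′ v′)) u′

    slack-decomposition : IsDecomposition T slack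
    slack-decomposition = label-decomposition (start∈ (path u′ v′)) to-root

    slack-apart : ∀ {c d} → c ≢ d → ¬ (c ∈[ u′ , v′ ] × d ∈[ u′ , v′ ]) → slack c ≢ slack d
    slack-apart = label-apart (start∈ (path u′ v′))

    slack-lhs : lhs (χ slack) ≡ 1ℚ
    slack-lhs = cong₂ _+q_
      (coord-separated slack (slack-apart u≢v (u∉[u′,v′] ∘ proj₁)))
      (coord-joined slack (label-joins (start∈ (path u′ v′)) (end∈ (path u′ v′))))

    slack-rhs : rhs (χ slack) ≡ 1ℚ +q 1ℚ
    slack-rhs = cong₂ _+q_
      (coord-separated slack (slack-apart u≢v′ (u∉[u′,v′] ∘ proj₁)))
      (coord-separated slack (slack-apart u′≢v (v∉[u′,v′] ∘ proj₂)))

    Face : Point n → Set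
    Face x = LMC T x × (lhs x ≡ rhs x)

    -- Applying `rhs` minus `lhs` to an affine relation kills the points on the face and leaves the
    -- coefficient of `χ slack`, where the difference is 1.
    extend-independent : ∀ {k} (z : Fin k → Point n) → (∀ i → Face (z i)) →
      AffinelyIndependent z → ∃ λ (z⁺ : Fin (suc k) → Point n) →
      (∀ i → LMC T (z⁺ i)) × AffinelyIndependent z⁺
    extend-independent {k} z face independent = z⁺ , in-LMC , independent⁺
      where
      z⁺ : Fin (suc k) → Point n
      z⁺ zero    = χ slack
      z⁺ (suc i) = z i

      in-LMC : ∀ i → LMC T (z⁺ i)
      in-LMC zero    = χ∈LMC slack-decomposition
      in-LMC (suc i) = proj₁ (face i)

      independent⁺ : AffinelyIndependent z⁺
      independent⁺ c ∑c≡0 rel = λ { zero → c₀≡0 ; (suc i) → independent (c ∘ suc)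
          (trans (drop₀ (c zero) (∑ (c ∘ suc)) c₀≡0) ∑c≡0)
          (λ p → trans (drop₀ (c zero *q χ slack p) (comb (c ∘ suc) (λ i → z i p))
            (trans (cong (_*q χ slack p) c₀≡0) (ℚ.*-zeroˡ (χ slack p)))) (rel p)) i }
        where
        drop₀ : ∀ x y → x ≡ 0ℚ → y ≡ x +q y
        drop₀ _ y refl = sym (ℚ.+-identityˡ y)

        functional : ∀ a b a′ b′ → comb c (λ i → coord (z⁺ i) a b +q coord (z⁺ i) a′ b′) ≡ 0ℚ
        functional a b a′ b′ = trans (sym (coord-pair-comb c z⁺ a b a′ b′))
          (cong₂ _+q_ (coord-zero a b) (coord-zero a′ b′))
          where
          coord-zero : ∀ a b → coord (λ p → comb c (λ i → z⁺ i p)) a b ≡ 0ℚ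
          coord-zero a b = trans (coord-cong rel a b) (constant a b)
            where
            constant : ∀ a b → coord (λ (_ : Pair n) → 0ℚ) a b ≡ 0ℚ
            constant a b with a <? b
            ... | yes _ = refl
            ... | no _ with b <? a
            ...   | yes _ = refl
            ...   | no _ = refl

        -- The face points contribute this same amount to both sides, so it cancels in the
        -- difference.
        R : ℚ
        R = comb (c ∘ suc) (lhs ∘ z)

        lhs-sum : c zero *q 1ℚ +q R ≡ 0ℚ
        lhs-sum = trans (cong (λ t → c zero *q t +q R) (sym slack-lhs)) (functional u v u′ v′)

        rhs-sum : c zero *q (1ℚ +q 1ℚ) +q R ≡ 0ℚ
        rhs-sum = trans
          (cong₂ (λ t s → c zero *q t +q s) (sym slack-rhs)
            (∑-cong λ i → cong (c (suc i) *q_) (proj₂ (face i))))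
          (functional u v′ u′ v)

        c₀≡0 : c zero ≡ 0ℚ
        c₀≡0 = trans
          (solve 2 (λ x y → x := (x :* (con 1ℚ :+ con 1ℚ) :+ y) :+ (:- (x :* con 1ℚ :+ y))) refl
            (c zero) R)
          (cong₂ (λ s t → s +q (- t)) rhs-sum lhs-sum)
          where open +-*-Solver

    -- The dimensions of `LMC T` and of the face, with `suc d` coordinates

    module _ {d : ℕ} (pairs : Fin (suc d) ↔ Pair n) where

      open Inverse pairs using (to; from; strictlyInverseˡ; strictlyInverseʳ)

      fst snd : Fin (suc d) → Fin n
      fst i = proj₁ (to i)
      snd i = proj₁ (proj₂ (to i))

      fst<snd : ∀ i → fst i < snd i
      fst<snd i = proj₂ (proj₂ (to i))

      to-≡ : ∀ {i j} → fst i ≡ fst j → snd i ≡ snd j → i ≡ j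
      to-≡ {i} {j} eq₁ eq₂ = trans (sym (strictlyInverseʳ i))
        (trans (cong from (pair-≡ eq₁ eq₂)) (strictlyInverseʳ j))

      block : Fin (suc d) → List (Fin n)
      block i = proj₁ (shape (fst i) (snd i))

      block-shape : ∀ i → Shape (fst i) (snd i) (block i)
      block-shape i = proj₂ (shape (fst i) (snd i))

      labelling : Fin (suc d) → Fin n → Fin n
      labelling i = label (block i) (fst i)

      face-point : Fin (suc d) → Point n
      face-point i = χ (labelling i)

      face-point∈Face : ∀ i → Face (face-point i)
      face-point∈Face i = χ∈LMC (block-decomposition (block-shape i)) ,
        tight⇒≡ (labelling i) (block-tight (block-shape i))

      -- The index of `u′v′`, whose face point has all coordinates 1.
      i₀ : Fin (suc d)
      i₀ = from (proj₁ (coord-pair u′≢v′))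

      i₀-ends : u′ ∈ fst i₀ ∷ snd i₀ ∷ [] × v′ ∈ fst i₀ ∷ snd i₀ ∷ []
      i₀-ends with subst (λ p → Ends p u′ v′) (sym (strictlyInverseˡ _))
                     (proj₂ (proj₂ (coord-pair u′≢v′)))
      ... | inj₁ (u′≡ , v′≡) = here u′≡ , there (here v′≡)
      ... | inj₂ (v′≡ , u′≡) = there (here u′≡) , here v′≡

      single⇒i₀ : ∀ i → u′ ∈ fst i ∷ snd i ∷ [] → v′ ∈ fst i ∷ snd i ∷ [] → i ≡ i₀
      single⇒i₀ i u′∈ v′∈ = trans (sym (strictlyInverseʳ i))
        (cong from (ends-unique (ends u′∈ v′∈) (proj₂ (proj₂ (coord-pair u′≢v′)))))
        where
        ends : u′ ∈ fst i ∷ snd i ∷ [] → v′ ∈ fst i ∷ snd i ∷ [] → Ends (to i) u′ v′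
        ends (here u′≡)         (here v′≡)         = contradiction (trans u′≡ (sym v′≡)) u′≢v′
        ends (there (here u′≡)) (there (here v′≡)) = contradiction (trans u′≡ (sym v′≡)) u′≢v′
        ends (here u′≡)         (there (here v′≡)) = inj₁ (u′≡ , v′≡)
        ends (there (here u′≡)) (here v′≡)         = inj₂ (v′≡ , u′≡)

      i₀-singletons : ∀ {S c e} → Shape (fst i₀) (snd i₀) S → c ∈ S → e ∈ S → c ≡ e
      i₀-singletons (single _ _) (here c≡) (here e≡) = trans c≡ (sym e≡)
      i₀-singletons (good ¬both _) _ _ = contradiction i₀-ends ¬both
      i₀-singletons (extended _ (inj₁ (refl , refl)) u′∉) _ _ = contradiction (proj₁ i₀-ends) u′∉
      i₀-singletons (extended _ (inj₂ (refl , refl)) v′∉) _ _ = contradiction (proj₂ i₀-ends) v′∉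

      meets : ∀ i j → face-point i (to j) ≡ 1ℚ ⊎ (fst j ∈ block i × snd j ∈ block i)
      meets i j = by-dec (labelling i (fst j) Fin.≟ labelling i (snd j))
        where
        by-dec : Dec (labelling i (fst j) ≡ labelling i (snd j)) → _
        by-dec (no apart)   = inj₁ (χ-separated (labelling i) (fst<snd j) apart)
        by-dec (yes joined) = inj₂ (Sum.fromInj₂
          (λ eq → contradiction (fst<snd j) (ℕ.<-irrefl (cong toℕ eq)))
          (label-≡ (root∈ (block-shape i)) joined))

      -- Column i₀ expresses ∑ c ≡ 0, the other columns say that c annihilates a coordinate of 1 − χ.
      M : Fin (suc d) → Fin (suc d) → ℚ
      M i j with j Fin.≟ i₀
      ... | yes _ = 1ℚ
      ... | no _  = 1ℚ +q (- face-point i (to j))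

      -- Column `i₀` of `M` is constantly 1 and row `i₀` vanishes off the diagonal, so `i₀` has to
      -- come before all other indices.
      rank₀ : Fin (suc d) → ℕ
      rank₀ i with i Fin.≟ i₀
      ... | yes _ = 0
      ... | no _  = suc (rank (fst i) (snd i))

      M-diag : ∀ i → M i i ≢ 0ℚ
      M-diag i eq with i Fin.≟ i₀
      ... | yes _ = contradiction eq λ ()
      ... | no i≢i₀ = contradiction
              (trans (cong (λ t → 1ℚ +q (- t)) (sym (χ-joined (labelling i) (fst<snd i)
                (label-joins (root∈ (block-shape i)) (snd∈ (block-shape i)))))) eq) λ ()
        where
        snd∈ : ∀ {S} → Shape (fst i) (snd i) S → snd i ∈ S
        snd∈ (good _ _)         = end∈ (path (fst i) (snd i))
        snd∈ (extended _ _ _) = there (end∈ (path (fst i) (snd i)))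
        snd∈ (single u′∈ v′∈) = contradiction (single⇒i₀ i u′∈ v′∈) i≢i₀

      M-off : ∀ i j → i ≢ j → M i j ≡ 0ℚ ⊎ rank₀ j ℕ.< rank₀ i
      M-off i j i≢j with j Fin.≟ i₀
      M-off i j i≢j | yes refl with i Fin.≟ i₀
      ... | yes i≡i₀ = contradiction i≡i₀ i≢j
      ... | no _ = inj₂ z<s
      M-off i j i≢j | no _ with meets i j
      ... | inj₁ x≡1 = inj₁ (cong (λ t → 1ℚ +q (- t)) x≡1)
      ... | inj₂ (c∈ , d∈) with i Fin.≟ i₀
      ...   | yes refl = contradiction (fst<snd j)
                           (ℕ.<-irrefl (cong toℕ (i₀-singletons (block-shape i₀) c∈ d∈)))
      ...   | no _ = inj₂ (s<s (block-rank (fst<snd i) (fst<snd j) (block-shape i) c∈ d∈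
                       λ (eq₁ , eq₂) → i≢j (sym (to-≡ eq₁ eq₂))))

      face-points-independent : AffinelyIndependent face-point
      face-points-independent c ∑c≡0 rel = triangular M rank₀ M-diag M-off c column
        where
        column : ∀ j → comb c (λ i → M i j) ≡ 0ℚ
        column j with j Fin.≟ i₀
        ... | yes _ = trans (comb-1 c) ∑c≡0
        ... | no _  = begin
          comb c (λ i → 1ℚ +q (- x i))                        ≡⟨ ℚ.+-identityʳ _ ⟨
          comb c (λ i → 1ℚ +q (- x i)) +q 0ℚ                  ≡⟨ cong (comb c (λ i → 1ℚ +q (- x i)) +q_)
                                                                   (rel (to j)) ⟨
          comb c (λ i → 1ℚ +q (- x i)) +q comb c x            ≡⟨ comb-+ c (λ i → 1ℚ +q (- x i)) x ⟨
          comb c (λ i → 1ℚ +q (- x i) +q x i)                 ≡⟨ ∑-cong (λ i → cong (c i *q_) (cancel (x i))) ⟩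
          comb c (λ _ → 1ℚ)                                   ≡⟨ comb-1 c ⟩
          ∑ c                                                 ≡⟨ ∑c≡0 ⟩
          0ℚ                                                  ∎
          where
          open ≡-Reasoning
          x : Fin (suc d) → ℚ
          x i = face-point i (to j)

          cancel : ∀ t → 1ℚ +q (- t) +q t ≡ 1ℚ
          cancel = solve 1 (λ t → con 1ℚ :+ (:- t) :+ t := con 1ℚ) refl
            where open +-*-Solver

      LMC-dim : HasDim (LMC T) (suc d)
      LMC-dim = extend-independent face-point face-point∈Face face-points-independent ,
        λ z _ → ¬independent z ℓ (determine z)
        where
        -- The constant functional together with all coordinates: one fewer than the number of
        -- points.
        ℓ : Fin (suc (suc d)) → Point n → ℚ
        ℓ zero    _ = 1ℚ
        ℓ (suc s) x = x (to s)

        determine : ∀ {k} (z : Fin k → Point n) c → (∀ s → comb c (ℓ s ∘ z) ≡ 0ℚ) →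
          ∑ c ≡ 0ℚ × (∀ p → comb c (λ i → z i p) ≡ 0ℚ)
        determine z c rel = trans (sym (comb-1 c)) (rel zero) , λ p →
          subst (λ q → comb c (λ i → z i q) ≡ 0ℚ) (strictlyInverseˡ p) (rel (suc (from p)))

      Face-dim : HasDim Face d
      Face-dim = (face-point , face-point∈Face , face-points-independent) ,
        λ z z∈ → ¬independent z ℓ (determine z (proj₂ ∘ z∈))
        where
        pᵤᵥ : Pair n
        pᵤᵥ = proj₁ (coord-pair u≢v)

        -- On the face the coordinate uv is determined by the others, which frees its slot for
        -- the constant functional.
        ℓ : Fin (suc d) → Point n → ℚ
        ℓ s x with to s ≟ₚ pᵤᵥ
        ... | yes _ = 1ℚ
        ... | no _  = x (to s)

        determine : ∀ {k} (z : Fin k → Point n) → (∀ i → lhs (z i) ≡ rhs (z i)) →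
          ∀ c → (∀ s → comb c (ℓ s ∘ z) ≡ 0ℚ) →
          ∑ c ≡ 0ℚ × (∀ p → comb c (λ i → z i p) ≡ 0ℚ)
        determine {k} z eqs c rel = ∑c≡0 , all-coordinates
          where
          ∑c≡0 : ∑ c ≡ 0ℚ
          ∑c≡0 with to (from pᵤᵥ) ≟ₚ pᵤᵥ | rel (from pᵤᵥ)
          ... | yes _ | eq = trans (sym (comb-1 c)) eq
          ... | no ≢  | _  = contradiction (strictlyInverseˡ pᵤᵥ) ≢

          other : ∀ p → p ≢ pᵤᵥ → comb c (λ i → z i p) ≡ 0ℚ
          other p p≢ with to (from p) ≟ₚ pᵤᵥ | rel (from p)
          ... | yes eq | _ = contradiction (trans (sym (strictlyInverseˡ p)) eq) p≢
          ... | no _   | eq = subst (λ q → comb c (λ i → z i q) ≡ 0ℚ) (strictlyInverseˡ p) eq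

          other-coord : ∀ {a b} → a ≢ b → ¬ (a ≡ u × b ≡ v) → ¬ (a ≡ v × b ≡ u) →
            comb c (λ i → coord (z i) a b) ≡ 0ℚ
          other-coord a≢b ≢uv ≢vu with coord-pair a≢b
          ... | p , coord≡ , ends = trans (∑-cong λ i → cong (c i *q_) (coord≡ (z i)))
            (other p λ p≡ → Sum.[ ≢uv , ≢vu ]
              (same-ends {p = pᵤᵥ} (subst (λ q → Ends q _ _) p≡ ends) (proj₂ (proj₂ (coord-pair u≢v)))))

          -- The face equation expresses this coordinate by those of `u′v′`, `uv′` and `u′v`, which
          -- are pairs different from `uv`.
          uv-coord : comb c (λ i → coord (z i) u v) ≡ 0ℚ
          uv-coord = begin
            comb c (X u v)                       ≡⟨ ℚ.+-identityʳ _ ⟨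
            comb c (X u v) +q 0ℚ                 ≡⟨ cong (comb c (X u v) +q_)
                                                      (other-coord u′≢v′ (u≢u′ ∘ sym ∘ proj₁) (u′≢v ∘ proj₁)) ⟨
            comb c (X u v) +q comb c (X u′ v′)   ≡⟨ comb-+ c (X u v) (X u′ v′) ⟨
            comb c (lhs ∘ z)                     ≡⟨ ∑-cong (λ i → cong (c i *q_) (eqs i)) ⟩
            comb c (rhs ∘ z)                     ≡⟨ comb-+ c (X u v′) (X u′ v) ⟩
            comb c (X u v′) +q comb c (X u′ v)   ≡⟨ cong₂ _+q_
                                                      (other-coord u≢v′ (v≢v′ ∘ sym ∘ proj₂) (u≢v ∘ proj₁))
                                                      (other-coord u′≢v (u≢u′ ∘ sym ∘ proj₁) (u′≢v ∘ proj₁)) ⟩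
            0ℚ                                   ∎
            where
            open ≡-Reasoning
            X : Fin n → Fin n → Fin k → ℚ
            X a b i = coord (z i) a b

          all-coordinates : ∀ p → comb c (λ i → z i p) ≡ 0ℚ
          all-coordinates p with p ≟ₚ pᵤᵥ
          ... | no p≢ = other p p≢
          ... | yes refl = trans
            (∑-cong λ i → cong (c i *q_) (sym (proj₁ (proj₂ (coord-pair u≢v)) (z i)))) uv-coord

    facet : DefinesFacet (LMC T) lhs rhs
    facet with pairs-finite n
    -- The distinct vertices `u` and `v` form a pair, so the number of pairs is a successor.
    ... | zero  , pairs = contradiction (Inverse.from pairs (proj₁ (coord-pair u≢v))) λ ()
    ... | suc d , pairs = valid , d , LMC-dim pairs , Face-dim pairs

-- From the vertex list of the path to the relations between its vertices

theorem6p10 : ∀ (n : ℕ) (T : Graph n) → IsTree T →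
    ∀ (u u′ v′ v : Fin n) (ms : List (Fin n)) (p : Walk T u v) → IsPath p →
    vertices p ≡ u ∷ u′ ∷ (ms ++ (v′ ∷ v ∷ [])) →
    DefinesFacet (LMC T)
    (λ x → coord x u v +q coord x u′ v′)
    (λ x → coord x u v′ +q coord x u′ v)
theorem6p10 n T tree u u′ v′ v ms here _ ()
theorem6p10 n T tree u u′ v′ v ms (step e w) (u∉ ∷ w-path) eq
  -- The first edge of the path ends at the second vertex of the list, which is `u′`.
  with refl ← head-vertices w (∷-injectiveʳ eq) =
  Intersection.facet T tree u u′ v′ v e (Adj-sym T (last-step w (u′ ∷ ms) eq′))
    (λ { refl → u∉w (end∈ w) }) (λ { refl → u∉w v′∈w })
    (u′≢ (∈-++⁺ʳ ms (there (here refl)))) (u′≢ (∈-++⁺ʳ ms (here refl)))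
    -- The rest `w` of the path and its initial part `before`, which ends at `v′`, both start at
    -- `u′` and avoid `u`.
    (detour e w u∉w) (detour e before (u∉w ∘ before⊆))
    (subst (v′ ∈_) (sym (path-unique w w-path)) v′∈w)
  where
  open Tree T tree
  eq′ : vertices w ≡ u′ ∷ ms ++ v′ ∷ v ∷ []
  eq′ = ∷-injectiveʳ eq
  u∉w : u ∉ vertices w
  u∉w = All¬⇒¬Any u∉
  v′∈w : v′ ∈ vertices w
  v′∈w = subst (v′ ∈_) (sym eq′) (there (∈-++⁺ʳ ms (here refl)))
  u′≢ : ∀ {x} → x ∈ ms ++ v′ ∷ v ∷ [] → u′ ≢ x
  u′≢ x∈ with subst Unique eq′ w-path
  ... | u′∉ ∷ _ = All.lookup u′∉ x∈
  open Split (split w v′∈w)
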